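{- Let $p$ be a prime number, let $k\ge 2$ and $n\ge 2$ be integers, and let $\epsilon_1,\epsilon_2\in\{ -1,+1\}$. Then the polynomial $f(x)=x^n+\epsilon_1 x+\epsilon_2 p^k$ is irreducible over $\mathbb{Q}$. -}

module Defs where

open import Data.Nat using (ℕ; zero; suc)
open import Data.Integer using (+_)
open import Data.Rational using (ℚ; 0ℚ; 1ℚ; _+_; _*_; _/_)
open import Data.List using (List; []; _∷_; map; replicate; _++_)
open import Data.Product using (_×_)
open import Data.Sum using (_⊎_)
open import Relation.Binary.PropositionalEquality using (_≡_)
open import Relation.Nullary using (¬_)

-- Polynomials over ℚ as coefficient lists, lowest degree first.
-- (Trailing zeros allowed; equality of polynomials is coefficientwise.)
Poly : Set
Poly = List ℚ

coeff : Poly → ℕ → ℚ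
coeff []       _       = 0ℚ
coeff (a ∷ _)  zero    = a
coeff (_ ∷ as) (suc i) = coeff as i

_+ₚ_ : Poly → Poly → Poly
[]       +ₚ q        = q
(a ∷ p)  +ₚ []       = a ∷ p
(a ∷ p)  +ₚ (b ∷ q)  = (a + b) ∷ (p +ₚ q)

_*ₚ_ : Poly → Poly → Poly
[]      *ₚ q = []
(a ∷ p) *ₚ q = map (a *_) q +ₚ (0ℚ ∷ (p *ₚ q))

_≈ₚ_ : Poly → Poly → Set
p ≈ₚ q = ∀ i → coeff p i ≡ coeff q i

C : ℚ → Poly
C c = c ∷ []

X^ : ℕ → Poly
X^ n = replicate n 0ℚ ++ (1ℚ ∷ [])

IsConstant : Poly → Set
IsConstant p = ∀ i → coeff p (suc i) ≡ 0ℚ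

-- Irreducible in ℚ[x]: not a unit and not zero (i.e. nonconstant), and in every
-- factorisation f = g h one factor is a unit (a nonzero constant; since f ≠ 0
-- both factors are nonzero, so "constant" suffices).
Irreducible : Poly → Set
Irreducible f = ¬ IsConstant f × (∀ g h → f ≈ₚ (g *ₚ h) → IsConstant g ⊎ IsConstant h)

ℕ→ℚ : ℕ → ℚ
ℕ→ℚ m = (+ m) / 1

{-# OPTIONS --safe #-}
module Submission where

-- By Gauss's lemma a factorisation of xⁿ + ε₁x + ε₂pᵏ may be taken over ℤ: f g = F. Since the
-- linear coefficient of F is ±1, p divides only one of f(0), g(0), so one of them, say f(0),
-- is ±1 and u = 1/f is a power series over ℤ. From F u = g the coefficients of u satisfy
-- ε₂pᵏ uₘ₊ₙ + ε₁ uₘ₊ₙ₋₁ + uₘ = 0 for large m, so pᵏ ≥ 4 forces these integers to decay to 0.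
-- Thus u is a polynomial, and f u = 1 makes f constant. (This replaces the usual argument that
-- all complex roots of F lie outside the unit circle.)

open import Defs
open import Data.Empty using (⊥-elim)
open import Data.Integer as ℤ using (ℤ; +_; ∣_∣; 0ℤ; 1ℤ)
import Data.Integer.Properties as ℤₚ
open import Data.Integer.Divisibility.Signed as ℤ∣ using (divides; ∣ᵤ⇒∣; ∣⇒∣ᵤ) renaming (_∣_ to _∣ℤ_)
open import Data.Integer.Tactic.RingSolver using (solve-∀)
open import Data.List using (List; []; _∷_; length; map)
open import Data.List.Relation.Unary.All using (All; []; _∷_)
open import Data.Nat as ℕ using (ℕ; zero; suc; _≤_; _<_; _^_; z≤n; s≤s; NonZero)
open import Data.Nat.Coprimality using (coprime-divisor)
open import Data.Nat.Divisibility as ℕ∣ using () renaming (_∣_ to _∣ℕ_)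
open import Data.Nat.ListAction using (product)
open import Data.Nat.Primality using (Prime; euclidsLemma; prime⇒irreducible; prime⇒nonZero; prime⇒nonTrivial; ¬prime[1])
open import Data.Nat.Primality.Factorisation using (PrimeFactorisation; factorise)
import Data.Nat.Properties as ℕₚ
open import Data.Nat.Tactic.RingSolver using () renaming (solve-∀ to ℕ-solve-∀)
open import Data.Product using (_×_; _,_; ∃-syntax; proj₁; proj₂)
open import Data.Rational as ℚ using (ℚ; 1ℚ; -_; _*_; mkℚ; toℚᵘ)
import Data.Rational.Properties as ℚₚ
open import Data.Rational.Solver using () renaming (module +-*-Solver to ℚ-Solver)
open import Data.Rational.Unnormalised as ℚᵘ using (mkℚᵘ; *≡*; _≃_)
import Data.Rational.Unnormalised.Properties as ℚᵘₚ
open import Data.Sum using (_⊎_; inj₁; inj₂)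
import Data.Sum as Sum
open import Function using (_∘_)
open import Relation.Binary.PropositionalEquality
  using (_≡_; _≢_; _≗_; refl; sym; trans; cong; cong₂; subst; module ≡-Reasoning)
open import Relation.Nullary using (¬_; yes; no)

-- Integer power series

Series : Set
Series = ℕ → ℤ

tail : Series → Series
tail f i = f (suc i)

infixl 7 _⊛_

_⊛_ : Series → Series → Series
(f ⊛ g) zero    = f 0 ℤ.* g 0
(f ⊛ g) (suc n) = f 0 ℤ.* g (suc n) ℤ.+ (tail f ⊛ g) n

X^ℤ : ℕ → Series
X^ℤ zero    zero    = 1ℤ
X^ℤ zero    (suc _) = 0ℤ
X^ℤ (suc n) zero    = 0ℤ
X^ℤ (suc n) (suc i) = X^ℤ n i

⊛-cong : ∀ {f f′ g g′} → f ≗ f′ → g ≗ g′ → f ⊛ g ≗ f′ ⊛ g′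
⊛-cong p q zero    = cong₂ ℤ._*_ (p 0) (q 0)
⊛-cong p q (suc n) =
  cong₂ ℤ._+_ (cong₂ ℤ._*_ (p 0) (q (suc n))) (⊛-cong (p ∘ suc) q n)

-- `_⊛_` recurses on its left factor. Peeling the constant coefficient off the right factor instead
-- gives commutativity and lets inductions shorten either factor.
⊛-sucʳ : ∀ f g n → (f ⊛ g) (suc n) ≡ (f ⊛ tail g) n ℤ.+ f (suc n) ℤ.* g 0
⊛-sucʳ f g zero    = refl
⊛-sucʳ f g (suc n) = begin
  f 0 ℤ.* g (2 ℕ.+ n) ℤ.+ (tail f ⊛ g) (suc n)
    ≡⟨ cong (λ z → f 0 ℤ.* g (2 ℕ.+ n) ℤ.+ z) (⊛-sucʳ (tail f) g n) ⟩
  f 0 ℤ.* g (2 ℕ.+ n) ℤ.+ ((tail f ⊛ tail g) n ℤ.+ f (2 ℕ.+ n) ℤ.* g 0)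
    ≡⟨ ℤₚ.+-assoc (f 0 ℤ.* g (2 ℕ.+ n)) _ _ ⟨
  f 0 ℤ.* g (2 ℕ.+ n) ℤ.+ (tail f ⊛ tail g) n ℤ.+ f (2 ℕ.+ n) ℤ.* g 0 ∎
  where open ≡-Reasoning

⊛-comm : ∀ f g → f ⊛ g ≗ g ⊛ f
⊛-comm f g zero    = ℤₚ.*-comm (f 0) (g 0)
⊛-comm f g (suc n) = begin
  f 0 ℤ.* g (suc n) ℤ.+ (tail f ⊛ g) n
    ≡⟨ ℤₚ.+-comm (f 0 ℤ.* g (suc n)) _ ⟩
  (tail f ⊛ g) n ℤ.+ f 0 ℤ.* g (suc n)
    ≡⟨ cong₂ ℤ._+_ (⊛-comm (tail f) g n) (ℤₚ.*-comm (f 0) (g (suc n))) ⟩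
  (g ⊛ tail f) n ℤ.+ g (suc n) ℤ.* f 0
    ≡⟨ ⊛-sucʳ g f n ⟨
  (g ⊛ f) (suc n) ∎
  where open ≡-Reasoning

-- Stated for this combination because `tail (f ⊛ g)` is by definition `f 0` times `tail g` plus
-- `tail f ⊛ g`, the left factor met in the proof of associativity.
⊛-linearˡ : ∀ a f g h n → ((λ i → a ℤ.* f i ℤ.+ g i) ⊛ h) n ≡ a ℤ.* (f ⊛ h) n ℤ.+ (g ⊛ h) n
⊛-linearˡ a f g h zero    = lemma a (f 0) (g 0) (h 0)
  where
  lemma : ∀ a b c d → (a ℤ.* b ℤ.+ c) ℤ.* d ≡ a ℤ.* (b ℤ.* d) ℤ.+ c ℤ.* d
  lemma = solve-∀
⊛-linearˡ a f g h (suc n) =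
  trans (cong (λ z → (a ℤ.* f 0 ℤ.+ g 0) ℤ.* h (suc n) ℤ.+ z) (⊛-linearˡ a (tail f) (tail g) h n))
        (lemma a (f 0) (g 0) (h (suc n)) ((tail f ⊛ h) n) ((tail g ⊛ h) n))
  where
  lemma : ∀ a b c d x y → (a ℤ.* b ℤ.+ c) ℤ.* d ℤ.+ (a ℤ.* x ℤ.+ y)
                        ≡ a ℤ.* (b ℤ.* d ℤ.+ x) ℤ.+ (c ℤ.* d ℤ.+ y)
  lemma = solve-∀

⊛-assoc : ∀ f g h → (f ⊛ g) ⊛ h ≗ f ⊛ (g ⊛ h)
⊛-assoc f g h zero    = ℤₚ.*-assoc (f 0) (g 0) (h 0)
⊛-assoc f g h (suc n) = begin
  f 0 ℤ.* g 0 ℤ.* h (suc n) ℤ.+ (tail (f ⊛ g) ⊛ h) n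
    ≡⟨ cong (λ z → f 0 ℤ.* g 0 ℤ.* h (suc n) ℤ.+ z) (⊛-linearˡ (f 0) (tail g) (tail f ⊛ g) h n) ⟩
  f 0 ℤ.* g 0 ℤ.* h (suc n) ℤ.+ (f 0 ℤ.* (tail g ⊛ h) n ℤ.+ ((tail f ⊛ g) ⊛ h) n)
    ≡⟨ cong (λ z → f 0 ℤ.* g 0 ℤ.* h (suc n) ℤ.+ (f 0 ℤ.* (tail g ⊛ h) n ℤ.+ z)) (⊛-assoc (tail f) g h n) ⟩
  f 0 ℤ.* g 0 ℤ.* h (suc n) ℤ.+ (f 0 ℤ.* (tail g ⊛ h) n ℤ.+ (tail f ⊛ (g ⊛ h)) n)
    ≡⟨ lemma (f 0) (g 0) (h (suc n)) _ _ ⟩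
  f 0 ℤ.* (g 0 ℤ.* h (suc n) ℤ.+ (tail g ⊛ h) n) ℤ.+ (tail f ⊛ (g ⊛ h)) n ∎
  where
  open ≡-Reasoning
  lemma : ∀ a b c x y → a ℤ.* b ℤ.* c ℤ.+ (a ℤ.* x ℤ.+ y) ≡ a ℤ.* (b ℤ.* c ℤ.+ x) ℤ.+ y
  lemma = solve-∀

⊛-zeroˡ : ∀ {f} g → (∀ i → f i ≡ 0ℤ) → ∀ n → (f ⊛ g) n ≡ 0ℤ
⊛-zeroˡ g f≗0 zero    rewrite f≗0 0 = ℤₚ.*-zeroˡ (g 0)
⊛-zeroˡ g f≗0 (suc n) rewrite f≗0 0 =
  cong₂ ℤ._+_ (ℤₚ.*-zeroˡ (g (suc n))) (⊛-zeroˡ g (f≗0 ∘ suc) n)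

⊛-scaleˡ : ∀ a f g n → ((λ i → a ℤ.* f i) ⊛ g) n ≡ a ℤ.* (f ⊛ g) n
⊛-scaleˡ a f g zero    = ℤₚ.*-assoc a (f 0) (g 0)
⊛-scaleˡ a f g (suc n) =
  trans (cong₂ ℤ._+_ (ℤₚ.*-assoc a (f 0) _) (⊛-scaleˡ a (tail f) g n))
        (sym (ℤₚ.*-distribˡ-+ a _ _))

X^⊛ : ∀ n g j → (X^ℤ n ⊛ g) (n ℕ.+ j) ≡ g j
X^⊛ zero    g zero    = ℤₚ.*-identityˡ (g 0)
X^⊛ zero    g (suc j) =
  trans (cong₂ ℤ._+_ (ℤₚ.*-identityˡ (g (suc j))) (⊛-zeroˡ g (λ _ → refl) j)) (ℤₚ.+-identityʳ _)
X^⊛ (suc n) g j       = trans (cong₂ ℤ._+_ (ℤₚ.*-zeroˡ (g (suc n ℕ.+ j))) (X^⊛ n g j)) (ℤₚ.+-identityˡ _)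

-- Since g 0 = ±1 is its own inverse, multiplying by it replaces division by it.
module Division (g : Series) (g₀²≡1 : g 0 ℤ.* g 0 ≡ 1ℤ) where

  -- One step of long division in ascending powers: `(r - q₀ g) / x` with `q₀ = g 0 · r 0`. The
  -- constant coefficient of `r - q₀ g` is zero since `g 0` squares to 1.
  remainder : Series → Series
  remainder r i = r (suc i) ℤ.+ ℤ.- (g (suc i) ℤ.* (g 0 ℤ.* r 0))

  quotient : Series → Series
  quotient r zero    = g 0 ℤ.* r 0
  quotient r (suc m) = quotient (remainder r) m

  ⊛-quotient : ∀ r → g ⊛ quotient r ≗ r
  ⊛-quotient r zero    = begin
    g 0 ℤ.* (g 0 ℤ.* r 0) ≡⟨ ℤₚ.*-assoc (g 0) (g 0) (r 0) ⟨
    g 0 ℤ.* g 0 ℤ.* r 0   ≡⟨ cong (ℤ._* r 0) g₀²≡1 ⟩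
    1ℤ ℤ.* r 0            ≡⟨ ℤₚ.*-identityˡ (r 0) ⟩
    r 0                   ∎
    where open ≡-Reasoning
  ⊛-quotient r (suc m) = begin
    (g ⊛ quotient r) (suc m)
      ≡⟨ ⊛-sucʳ g (quotient r) m ⟩
    (g ⊛ quotient (remainder r)) m ℤ.+ g (suc m) ℤ.* (g 0 ℤ.* r 0)
      ≡⟨ cong (ℤ._+ g (suc m) ℤ.* (g 0 ℤ.* r 0)) (⊛-quotient (remainder r) m) ⟩
    r (suc m) ℤ.+ ℤ.- (g (suc m) ℤ.* (g 0 ℤ.* r 0)) ℤ.+ g (suc m) ℤ.* (g 0 ℤ.* r 0)
      ≡⟨ lemma (r (suc m)) _ ⟩
    r (suc m) ∎
    where
    open ≡-Reasoning
    lemma : ∀ x y → x ℤ.+ ℤ.- y ℤ.+ y ≡ x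
    lemma = solve-∀

-- Polynomials as series that vanish eventually

VanishesFrom : ℕ → Series → Set
VanishesFrom a f = ∀ i → a ≤ i → f i ≡ 0ℤ

Constant : Series → Set
Constant f = VanishesFrom 1 f

tail-vanishes : ∀ {a f} → VanishesFrom (suc a) f → VanishesFrom a (tail f)
tail-vanishes f∞ i a≤i = f∞ (suc i) (s≤s a≤i)

lower-bound : ∀ {a f} → VanishesFrom (suc a) f → f a ≡ 0ℤ → VanishesFrom a f
lower-bound f∞ fa≡0 i a≤i with ℕₚ.m≤n⇒m<n∨m≡n a≤i
... | inj₁ a<i  = f∞ i a<i
... | inj₂ refl = fa≡0

-- Every other term `f i · g j` with `i + j = a + b` has `i > a` or `j > b`. The two remaining
-- coefficients may themselves be zero.
⊛-leading : ∀ a b f g → VanishesFrom (suc a) f → VanishesFrom (suc b) g →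
            (f ⊛ g) (a ℕ.+ b) ≡ f a ℤ.* g b
⊛-leading zero    zero    f g f∞ g∞ = refl
⊛-leading zero    (suc b) f g f∞ g∞ =
  trans (cong (λ z → f 0 ℤ.* g (suc b) ℤ.+ z) (⊛-zeroˡ g (λ i → f∞ (suc i) (s≤s z≤n)) b)) (ℤₚ.+-identityʳ _)
⊛-leading (suc a) b       f g f∞ g∞ = trans
  (cong₂ ℤ._+_
    (trans (cong (f 0 ℤ.*_) (g∞ _ (s≤s (ℕₚ.m≤n+m b a)))) (ℤₚ.*-zeroʳ (f 0)))
    (⊛-leading a b (tail f) g (tail-vanishes f∞) g∞))
  (ℤₚ.+-identityˡ _)

-- Degrees add because ℤ is a domain. The bounds need not be attained: while `a` is positive, the
-- product of the coefficients at the two bounds is zero, so one of the bounds drops.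
constant-factor : ∀ a b f g → VanishesFrom (suc a) f → VanishesFrom b g →
                  g 0 ≢ 0ℤ → Constant (f ⊛ g) → Constant f
constant-factor zero    b       f g f∞ g∞ g₀≢0 fg∞ = f∞
constant-factor (suc a) zero    f g f∞ g∞ g₀≢0 fg∞ = ⊥-elim (g₀≢0 (g∞ 0 z≤n))
constant-factor (suc a) (suc b) f g f∞ g∞ g₀≢0 fg∞
  with ℤₚ.i*j≡0⇒i≡0∨j≡0 (f (suc a)) (trans (sym (⊛-leading (suc a) b f g f∞ g∞)) (fg∞ _ (s≤s z≤n)))
... | inj₁ top≡0 = constant-factor a (suc b) f g (lower-bound f∞ top≡0) g∞ g₀≢0 fg∞
... | inj₂ top≡0 = constant-factor (suc a) b f g f∞ (lower-bound g∞ top≡0) g₀≢0 fg∞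

-- Gauss's lemma

-- Induction on both length bounds. The prime divides `f 0 · g 0`, hence one of the two; removing
-- that coefficient from its factor keeps the product divisible by `q`. A factor with bound zero is
-- the zero series.
prime∣⊛ : ∀ {q} → Prime q → ∀ a b f g → VanishesFrom a f → VanishesFrom b g →
          (∀ i → + q ∣ℤ (f ⊛ g) i) → (∀ i → + q ∣ℤ f i) ⊎ (∀ i → + q ∣ℤ g i)
prime∣⊛ {q} pr zero    b       f g f∞ g∞ q∣fg =
  inj₁ (λ i → divides 0ℤ (trans (f∞ i z≤n) (sym (ℤₚ.*-zeroˡ (+ q)))))
prime∣⊛ {q} pr (suc a) zero    f g f∞ g∞ q∣fg =
  inj₂ (λ i → divides 0ℤ (trans (g∞ i z≤n) (sym (ℤₚ.*-zeroˡ (+ q)))))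
prime∣⊛ {q} pr (suc a) (suc b) f g f∞ g∞ q∣fg
  with euclidsLemma ∣ f 0 ∣ ∣ g 0 ∣ pr (subst (q ∣ℕ_) (ℤₚ.abs-* (f 0) (g 0)) (∣⇒∣ᵤ (q∣fg 0)))
... | inj₁ q∣f₀ = Sum.map₁ (λ q∣tf → λ { zero → ∣ᵤ⇒∣ {i = f 0} q∣f₀ ; (suc i) → q∣tf i })
      (prime∣⊛ pr a (suc b) (tail f) g (tail-vanishes f∞) g∞
        (λ i → ℤ∣.∣m+n∣m⇒∣n (q∣fg (suc i)) (ℤ∣.∣m⇒∣m*n {m = f 0} (g (suc i)) (∣ᵤ⇒∣ {i = f 0} q∣f₀))))
... | inj₂ q∣g₀ = Sum.map₂ (λ q∣tg → λ { zero → ∣ᵤ⇒∣ {i = g 0} q∣g₀ ; (suc i) → q∣tg i })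
      (prime∣⊛ pr (suc a) b f (tail g) f∞ (tail-vanishes g∞)
        (λ i → ℤ∣.∣m+n∣n⇒∣m (subst (+ q ∣ℤ_) (⊛-sucʳ f g i) (q∣fg (suc i)))
                 (ℤ∣.∣n⇒∣m*n (f (suc i)) {g 0} (∣ᵤ⇒∣ {i = g 0} q∣g₀))))

record Quotient (d : ℤ) (f : Series) : Set where
  field
    quot  : Series
    scale : ∀ i → f i ≡ d ℤ.* quot i
open Quotient

divideBy : ∀ {d f} → (∀ i → d ∣ℤ f i) → Quotient d f
divideBy {d} d∣f = record
  { quot  = λ i → _∣ℤ_.quotient (d∣f i)
  ; scale = λ i → trans (_∣ℤ_.equality (d∣f i)) (ℤₚ.*-comm (_∣ℤ_.quotient (d∣f i)) d)
  }

quot-vanishes : ∀ {d f a} .{{_ : ℤ.NonZero d}} (Q : Quotient d f) →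
                VanishesFrom a f → VanishesFrom a (quot Q)
quot-vanishes {d} Q f∞ i a≤i =
  ℤₚ.*-cancelˡ-≡ d _ _ (trans (sym (scale Q i)) (trans (f∞ i a≤i) (sym (ℤₚ.*-zeroʳ d))))

quot-constant : ∀ {d f} (Q : Quotient d f) → Constant (quot Q) → Constant f
quot-constant {d} Q q∞ i 1≤i = trans (scale Q i) (trans (cong (d ℤ.*_) (q∞ i 1≤i)) (ℤₚ.*-zeroʳ d))

quot-⊛ : ∀ {d f} .{{_ : ℤ.NonZero d}} (Q : Quotient d f) (g h : Series) (N : ℤ) →
         (∀ i → (f ⊛ g) i ≡ d ℤ.* N ℤ.* h i) → ∀ i → (quot Q ⊛ g) i ≡ N ℤ.* h i
quot-⊛ {d} {f} Q g h N fg i = ℤₚ.*-cancelˡ-≡ d _ _ (begin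
  d ℤ.* (quot Q ⊛ g) i                ≡⟨ ⊛-scaleˡ d (quot Q) g i ⟨
  ((λ j → d ℤ.* quot Q j) ⊛ g) i      ≡⟨ ⊛-cong (sym ∘ scale Q) (λ _ → refl) i ⟩
  (f ⊛ g) i                           ≡⟨ fg i ⟩
  d ℤ.* N ℤ.* h i                     ≡⟨ ℤₚ.*-assoc d N (h i) ⟩
  d ℤ.* (N ℤ.* h i)                   ∎)
  where open ≡-Reasoning

-- Any integer constant is allowed as a trivial factor, not only ±1, since all nonzero constants are
-- units over ℚ.
IrreducibleOverℤ : Series → Set
IrreducibleOverℤ h = ∀ a b f g → VanishesFrom a f → VanishesFrom b g →
                     f ⊛ g ≗ h → Constant f ⊎ Constant g

-- The primes of the common denominator are removed one at a time: each divides all of `f` or all of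
-- `g`, and dividing it out affects neither the bounds nor constancy.
gauss : ∀ {h} → IrreducibleOverℤ h → ∀ qs → All Prime qs →
        ∀ a b f g → VanishesFrom a f → VanishesFrom b g →
        (∀ i → (f ⊛ g) i ≡ + product qs ℤ.* h i) → Constant f ⊎ Constant g
gauss irr [] [] a b f g f∞ g∞ fg = irr a b f g f∞ g∞ (λ i → trans (fg i) (ℤₚ.*-identityˡ _))
gauss {h} irr (q ∷ qs) (pr ∷ prs) a b f g f∞ g∞ fg = result
  where
  instance
    q≢0 : NonZero q
    q≢0 = prime⇒nonZero pr
  fg′ : ∀ i → (f ⊛ g) i ≡ + q ℤ.* + product qs ℤ.* h i
  fg′ i = trans (fg i) (cong (ℤ._* h i) (ℤₚ.pos-* q (product qs)))
  result : Constant f ⊎ Constant g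
  result with prime∣⊛ pr a b f g f∞ g∞
                (λ i → subst (+ q ∣ℤ_) (sym (fg′ i))
                         (ℤ∣.∣m⇒∣m*n (h i) (ℤ∣.∣m⇒∣m*n (+ product qs) ℤ∣.∣-refl)))
  ... | inj₁ q∣f = Sum.map₁ (quot-constant F)
        (gauss irr qs prs a b (quot F) g (quot-vanishes F f∞) g∞
          (quot-⊛ F g h (+ product qs) fg′))
        where
        F : Quotient (+ q) f
        F = divideBy q∣f
  ... | inj₂ q∣g = Sum.map₂ (quot-constant G)
        (gauss irr qs prs a b f (quot G) f∞ (quot-vanishes G g∞)
          -- `quot-⊛` divides the left factor, so the product is commuted before and after.
          (λ i → trans (⊛-comm f (quot G) i)
                   (quot-⊛ G f h (+ product qs) (λ j → trans (⊛-comm g f j) (fg′ j)) i)))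
        where
        G : Quotient (+ q) g
        G = divideBy q∣g

-- The trinomial c + e x + xⁿ⁺²

trinomial : ℤ → ℤ → ℕ → Series
trinomial c e n zero          = c
trinomial c e n (suc zero)    = e
trinomial c e n (suc (suc i)) = X^ℤ n i

-- Decay of integer solutions of the recurrence

prefix-bounded : (u : Series) → ∀ k → ∃[ M ] (∀ i → i < k → ∣ u i ∣ ≤ M)
prefix-bounded u zero    = 0 , λ _ ()
prefix-bounded u (suc k) with prefix-bounded u k
... | M , bound = M ℕ.+ ∣ u k ∣ , λ i i<1+k → case i (ℕₚ.m<1+n⇒m<n∨m≡n i<1+k)
  where
  case : ∀ i → i < k ⊎ i ≡ k → ∣ u i ∣ ≤ M ℕ.+ ∣ u k ∣
  case i (inj₁ i<k)  = ℕₚ.m≤n⇒m≤n+o ∣ u k ∣ (bound i i<k)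
  case i (inj₂ refl) = ℕₚ.m≤n+m ∣ u k ∣ M

-- A solution of the recurrence at least halves in every n + 2 steps because |c| ≥ 4;
-- being integral, it must vanish eventually.
module Decay (c e : ℤ) (4≤c : 4 ≤ ∣ c ∣) (∣e∣≡1 : ∣ e ∣ ≡ 1) (n b : ℕ) (u : Series)
  (recurrence : ∀ j → b ≤ j → c ℤ.* u (2 ℕ.+ n ℕ.+ j) ℤ.+ (e ℤ.* u (1 ℕ.+ n ℕ.+ j) ℤ.+ u j) ≡ 0ℤ)
  where

  -- With `x` the newest term and `y` the one before it, `c x = -(e y + u j)` gives
  -- `4|x| ≤ |y| + |u j| ≤ 2M`, and a factor 2 cancels.
  halving : ∀ M j → b ≤ j → ∣ u (1 ℕ.+ n ℕ.+ j) ∣ ≤ M → ∣ u j ∣ ≤ M → 2 ℕ.* ∣ u (2 ℕ.+ n ℕ.+ j) ∣ ≤ M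
  halving M j b≤j p q = ℕₚ.*-cancelˡ-≤ 2 (begin
    2 ℕ.* (2 ℕ.* ∣ x ∣)               ≡⟨ ℕₚ.*-assoc 2 2 ∣ x ∣ ⟨
    4 ℕ.* ∣ x ∣                       ≤⟨ ℕₚ.*-monoˡ-≤ ∣ x ∣ 4≤c ⟩
    ∣ c ∣ ℕ.* ∣ x ∣                   ≡⟨ ℤₚ.abs-* c x ⟨
    ∣ c ℤ.* x ∣                       ≡⟨ ℤₚ.∣-i∣≡∣i∣ (c ℤ.* x) ⟨
    ∣ ℤ.- (c ℤ.* x) ∣                 ≡⟨ cong ∣_∣ (negate (c ℤ.* x) _ (recurrence j b≤j)) ⟩
    ∣ e ℤ.* y ℤ.+ u j ∣               ≤⟨ ℤₚ.∣i+j∣≤∣i∣+∣j∣ (e ℤ.* y) (u j) ⟩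
    ∣ e ℤ.* y ∣ ℕ.+ ∣ u j ∣           ≡⟨ cong (ℕ._+ ∣ u j ∣) (ℤₚ.abs-* e y) ⟩
    ∣ e ∣ ℕ.* ∣ y ∣ ℕ.+ ∣ u j ∣       ≡⟨ cong (λ z → z ℕ.* ∣ y ∣ ℕ.+ ∣ u j ∣) ∣e∣≡1 ⟩
    1 ℕ.* ∣ y ∣ ℕ.+ ∣ u j ∣           ≡⟨ cong (ℕ._+ ∣ u j ∣) (ℕₚ.*-identityˡ ∣ y ∣) ⟩
    ∣ y ∣ ℕ.+ ∣ u j ∣                 ≤⟨ ℕₚ.+-mono-≤ p q ⟩
    M ℕ.+ M                           ≡⟨ cong (M ℕ.+_) (ℕₚ.+-identityʳ M) ⟨
    2 ℕ.* M                           ∎)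
    where
    open ℕₚ.≤-Reasoning
    x y : ℤ
    x = u (2 ℕ.+ n ℕ.+ j)
    y = u (1 ℕ.+ n ℕ.+ j)
    negate : ∀ a d → a ℤ.+ d ≡ 0ℤ → ℤ.- a ≡ d
    negate a d a+d≡0 = trans (lemma a d) (trans (cong (ℤ._+ d) (cong ℤ.-_ a+d≡0)) (ℤₚ.+-identityˡ d))
      where
      lemma : ∀ a d → ℤ.- a ≡ ℤ.- (a ℤ.+ d) ℤ.+ d
      lemma = solve-∀

  -- A bound for the first `2 + n + b` terms persists, since by `halving` each later term is at most
  -- half of it.
  bounded : ∃[ M ] (∀ i → ∣ u i ∣ ≤ M)
  bounded with prefix-bounded u (2 ℕ.+ n ℕ.+ b)
  -- `extend t` reaches `t` terms beyond the initial segment, so `t = i` always covers index `i`.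
  ... | M , bound = M , λ i → extend i i (ℕₚ.m<m+n i (s≤s z≤n))
    where
    extend : ∀ t i → i < t ℕ.+ (2 ℕ.+ n ℕ.+ b) → ∣ u i ∣ ≤ M
    extend zero    i i<k = bound i i<k
    extend (suc t) i i<k with ℕₚ.m<1+n⇒m<n∨m≡n i<k
    ... | inj₁ i<k′ = extend t i i<k′
    ... | inj₂ refl = subst (λ k → ∣ u k ∣ ≤ M) (sym index)
          (ℕₚ.≤-trans (ℕₚ.m≤n*m _ 2)
            (halving M (t ℕ.+ b) (ℕₚ.m≤n+m b t)
              (extend t _ (ℕₚ.≤-reflexive (sym index)))
              (extend t _ (subst (t ℕ.+ b <_) (sym index) (s≤s (ℕₚ.m≤n+m (t ℕ.+ b) (suc n)))))))
      where
      index : t ℕ.+ (2 ℕ.+ n ℕ.+ b) ≡ 2 ℕ.+ n ℕ.+ (t ℕ.+ b)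
      index = lemma t n b
        where
        lemma : ∀ t n b → t ℕ.+ (2 ℕ.+ n ℕ.+ b) ≡ 2 ℕ.+ n ℕ.+ (t ℕ.+ b)
        lemma = ℕ-solve-∀

  -- Induction on the bound: `n + 2` places further on, every term satisfies `2|x| ≤ M + 1`, which
  -- for integers already forces `|x| ≤ M`.
  descend : ∀ M s → b ≤ s → (∀ i → s ≤ i → ∣ u i ∣ ≤ M) → ∃[ s′ ] VanishesFrom s′ u
  descend zero    s b≤s bound = s , λ i s≤i → ℤₚ.∣i∣≡0⇒i≡0 (ℕₚ.n≤0⇒n≡0 (bound i s≤i))
  descend (suc M) s b≤s bound = descend M (2 ℕ.+ n ℕ.+ s) (ℕₚ.m≤n⇒m≤o+n (2 ℕ.+ n) b≤s) smaller
    where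
    halves : ∀ x → 2 ℕ.* x ≤ suc M → x ≤ M
    halves zero    _ = z≤n
    halves (suc x) (s≤s p) = ℕₚ.≤-trans (subst (suc x ≤_) (sym (ℕₚ.+-suc x _)) (s≤s (ℕₚ.m≤m+n x _))) p
    smaller : ∀ i → 2 ℕ.+ n ℕ.+ s ≤ i → ∣ u i ∣ ≤ M
    smaller i k≤i with ℕₚ.m≤n⇒∃[o]m+o≡n k≤i
    ... | o , refl rewrite ℕₚ.+-assoc n s o =
      halves _ (halving (suc M) (s ℕ.+ o) (ℕₚ.m≤n⇒m≤n+o o b≤s)
        (bound _ (ℕₚ.m≤n⇒m≤o+n (suc n) (ℕₚ.m≤m+n s o)))
        (bound _ (ℕₚ.m≤m+n s o)))

  vanishes : ∃[ s ] VanishesFrom s u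
  vanishes with bounded
  ... | M , bound = descend M b ℕₚ.≤-refl (λ i _ → bound i)

-- Irreducibility of the trinomial over ℤ

square-of-unit : ∀ i → ∣ i ∣ ≡ 1 → i ℤ.* i ≡ 1ℤ
square-of-unit (+ 1)            refl = refl
square-of-unit ℤ.-[1+ 0 ]       refl = refl

trinomial-unit-factor : ∀ c e n → 4 ≤ ∣ c ∣ → ∣ e ∣ ≡ 1 →
  ∀ a b f g → VanishesFrom a f → VanishesFrom b g → f ⊛ g ≗ trinomial c e n → ∣ f 0 ∣ ≡ 1 → Constant f
trinomial-unit-factor c e n 4≤c ∣e∣≡1 a b f g f∞ g∞ fg ∣f₀∣≡1 =
  -- The product `f ⊛ u` is 1 and both factors are now polynomials. The bound on `f` is weakened
  -- from `a` to `suc a` to fit `constant-factor`.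
  constant-factor a (proj₁ u∞) f u (λ i 1+a≤i → f∞ i (ℕₚ.<⇒≤ 1+a≤i)) (proj₂ u∞) u₀≢0
    (λ { (suc i) _ → fu (suc i) })
  where
  F : Series
  F = trinomial c e n
  open Division f (square-of-unit (f 0) ∣f₀∣≡1)
  u : Series
  u = quotient (X^ℤ 0)
  fu : f ⊛ u ≗ X^ℤ 0
  fu = ⊛-quotient (X^ℤ 0)
  Fu : F ⊛ u ≗ g
  Fu i = begin
    (F ⊛ u) i            ≡⟨ ⊛-cong (λ j → trans (sym (fg j)) (⊛-comm f g j)) (λ _ → refl) i ⟩
    ((g ⊛ f) ⊛ u) i      ≡⟨ ⊛-assoc g f u i ⟩
    (g ⊛ (f ⊛ u)) i      ≡⟨ ⊛-comm g (f ⊛ u) i ⟩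
    ((f ⊛ u) ⊛ g) i      ≡⟨ ⊛-cong fu (λ _ → refl) i ⟩
    (X^ℤ 0 ⊛ g) i        ≡⟨ X^⊛ 0 g i ⟩
    g i                  ∎
    where open ≡-Reasoning
  recurrence : ∀ j → b ≤ j → c ℤ.* u (2 ℕ.+ n ℕ.+ j) ℤ.+ (e ℤ.* u (1 ℕ.+ n ℕ.+ j) ℤ.+ u j) ≡ 0ℤ
  -- Coefficient `2 + n + j` of `F ⊛ u` unfolds to the left side with `u j` in the form
  -- `(X^ℤ n ⊛ u) (n + j)`; it equals a coefficient of `g` beyond its bound.
  recurrence j b≤j = trans
    (cong (λ z → c ℤ.* u (2 ℕ.+ n ℕ.+ j) ℤ.+ (e ℤ.* u (1 ℕ.+ n ℕ.+ j) ℤ.+ z)) (sym (X^⊛ n u j)))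
    (trans (Fu (2 ℕ.+ n ℕ.+ j)) (g∞ _ (ℕₚ.m≤n⇒m≤o+n (2 ℕ.+ n) b≤j)))
  u∞ : ∃[ s ] VanishesFrom s u
  u∞ = Decay.vanishes c e 4≤c ∣e∣≡1 n b u recurrence
  u₀≢0 : u 0 ≢ 0ℤ
  u₀≢0 u₀≡0 with trans (sym (fu 0)) (trans (cong (f 0 ℤ.*_) u₀≡0) (ℤₚ.*-zeroʳ (f 0)))
  ... | ()

-- Since `m` is coprime to `p`, the factors `p` can be cancelled from the power one by one until `m`
-- divides 1.
∤∧∣^⇒≡1 : ∀ {p} → Prime p → ∀ {m} k → ¬ p ∣ℕ m → m ∣ℕ p ^ k → m ≡ 1
∤∧∣^⇒≡1 pr zero    p∤m m∣1 = ℕ∣.∣1⇒≡1 m∣1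
∤∧∣^⇒≡1 {p} pr {m} (suc k) p∤m m∣pᵏ = ∤∧∣^⇒≡1 pr k p∤m (coprime-divisor coprime m∣pᵏ)
  where
  coprime : ∀ {d} → d ∣ℕ m × d ∣ℕ p → d ≡ 1
  coprime (d∣m , d∣p) with prime⇒irreducible pr d∣p
  ... | inj₁ d≡1  = d≡1
  ... | inj₂ refl = ⊥-elim (p∤m d∣m)

-- `4 = 2² ≤ 2ᵏ ≤ pᵏ`; this is the size of the constant coefficient that drives the decay.
4≤prime^ : ∀ {p} k → Prime p → 2 ≤ k → 4 ≤ p ^ k
4≤prime^ {p} k pr 2≤k = ℕₚ.≤-trans (ℕₚ.^-monoʳ-≤ 2 2≤k) (ℕₚ.^-monoˡ-≤ k (ℕ.nonTrivial⇒n>1 p))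
  where
  instance
    p>1 : ℕ.NonTrivial p
    p>1 = prime⇒nonTrivial pr

-- Modulo p the root 0 of x (xⁿ⁺¹ + e) is simple, so p divides only one of the constant
-- coefficients of the factors, and the other one is ±1.
trinomial-irreducible : ∀ {p} k → Prime p → 2 ≤ k → ∀ c e n → ∣ c ∣ ≡ p ^ k → ∣ e ∣ ≡ 1 →
                        IrreducibleOverℤ (trinomial c e n)
trinomial-irreducible {p} k pr 2≤k c e n ∣c∣≡pᵏ ∣e∣≡1 a b f g f∞ g∞ fg = result
  where
  4≤c : 4 ≤ ∣ c ∣
  4≤c = subst (4 ≤_) (sym ∣c∣≡pᵏ) (4≤prime^ k pr 2≤k)

  unit : ∀ i j → i ℤ.* j ≡ c → ¬ p ∣ℕ ∣ i ∣ → ∣ i ∣ ≡ 1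
  unit i j ij≡c p∤i = ∤∧∣^⇒≡1 pr k p∤i
    (ℕ∣.divides ∣ j ∣ (trans (sym ∣c∣≡pᵏ) (trans (cong ∣_∣ (sym ij≡c))
      (trans (ℤₚ.abs-* i j) (ℕₚ.*-comm ∣ i ∣ ∣ j ∣)))))

  gf : g ⊛ f ≗ trinomial c e n
  gf i = trans (⊛-comm g f i) (fg i)

  not-both : ¬ (p ∣ℕ ∣ f 0 ∣ × p ∣ℕ ∣ g 0 ∣)
  not-both (p∣f₀ , p∣g₀) = ¬prime[1] (subst Prime (ℕ∣.∣1⇒≡1 (subst (p ∣ℕ_) ∣e∣≡1 (∣⇒∣ᵤ p∣e))) pr)
    where
    p∣e : + p ∣ℤ e
    -- The linear coefficient is `e = f 0 · g 1 + f 1 · g 0`.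
    p∣e = subst (+ p ∣ℤ_) (fg 1)
      (ℤ∣.∣m∣n⇒∣m+n (ℤ∣.∣m⇒∣m*n {m = f 0} (g 1) (∣ᵤ⇒∣ {i = f 0} p∣f₀))
                    (ℤ∣.∣n⇒∣m*n (f 1) {g 0} (∣ᵤ⇒∣ {i = g 0} p∣g₀)))

  result : Constant f ⊎ Constant g
  result with p ℕ∣.∣? ∣ f 0 ∣ | p ℕ∣.∣? ∣ g 0 ∣
  ... | no p∤f₀  | _        = inj₁ (trinomial-unit-factor c e n 4≤c ∣e∣≡1 a b f g f∞ g∞ fg
                                (unit (f 0) (g 0) (fg 0) p∤f₀))
  ... | yes p∣f₀ | no p∤g₀  = inj₂ (trinomial-unit-factor c e n 4≤c ∣e∣≡1 b a g f g∞ f∞ gf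
                                (unit (g 0) (f 0) (gf 0) p∤g₀))
  ... | yes p∣f₀ | yes p∣g₀ = ⊥-elim (not-both (p∣f₀ , p∣g₀))

-- Clearing denominators

ι : ℤ → ℚ
ι z = z ℚ./ 1

toℚᵘ-ι : ∀ z → toℚᵘ (ι z) ≃ mkℚᵘ z 0
toℚᵘ-ι z = ℚₚ.toℚᵘ-fromℚᵘ (mkℚᵘ z 0)

ι-injective : ∀ {x y} → ι x ≡ ι y → x ≡ y
ι-injective {x} {y} eq with ℚₚ.fromℚᵘ-injective {mkℚᵘ x 0} {mkℚᵘ y 0} eq
... | *≡* x*1≡y*1 = trans (sym (ℤₚ.*-identityʳ x)) (trans x*1≡y*1 (ℤₚ.*-identityʳ y))

ι-+ : ∀ x y → ι (x ℤ.+ y) ≡ ι x ℚ.+ ι y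
ι-+ x y = ℚₚ.toℚᵘ-injective (begin
  toℚᵘ (ι (x ℤ.+ y))            ≈⟨ toℚᵘ-ι (x ℤ.+ y) ⟩
  mkℚᵘ (x ℤ.+ y) 0              ≈⟨ *≡* (lemma x y) ⟩
  mkℚᵘ x 0 ℚᵘ.+ mkℚᵘ y 0        ≈⟨ ℚᵘₚ.+-cong (toℚᵘ-ι x) (toℚᵘ-ι y) ⟨
  toℚᵘ (ι x) ℚᵘ.+ toℚᵘ (ι y)    ≈⟨ ℚₚ.toℚᵘ-homo-+ (ι x) (ι y) ⟨
  toℚᵘ (ι x ℚ.+ ι y)            ∎)
  where
  open import Relation.Binary.Reasoning.Setoid ℚᵘₚ.≃-setoid
  lemma : ∀ x y → (x ℤ.+ y) ℤ.* 1ℤ ≡ (x ℤ.* 1ℤ ℤ.+ y ℤ.* 1ℤ) ℤ.* 1ℤ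
  lemma = solve-∀

ι-* : ∀ x y → ι (x ℤ.* y) ≡ ι x * ι y
ι-* x y = ℚₚ.toℚᵘ-injective (begin
  toℚᵘ (ι (x ℤ.* y))            ≈⟨ toℚᵘ-ι (x ℤ.* y) ⟩
  mkℚᵘ x 0 ℚᵘ.* mkℚᵘ y 0        ≈⟨ ℚᵘₚ.*-cong (toℚᵘ-ι x) (toℚᵘ-ι y) ⟨
  toℚᵘ (ι x) ℚᵘ.* toℚᵘ (ι y)    ≈⟨ ℚₚ.toℚᵘ-homo-* (ι x) (ι y) ⟨
  toℚᵘ (ι x * ι y)              ∎)
  where open import Relation.Binary.Reasoning.Setoid ℚᵘₚ.≃-setoid

ι-↥ : ∀ a → ι (ℚ.↥ a) ≡ ι (ℚ.↧ a) * a
ι-↥ a@(mkℚ n d-1 _) = ℚₚ.toℚᵘ-injective (begin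
  toℚᵘ (ι n)                         ≈⟨ toℚᵘ-ι n ⟩
  mkℚᵘ n 0                           ≈⟨ *≡* (lemma n (+ suc d-1)) ⟩
  mkℚᵘ (+ suc d-1) 0 ℚᵘ.* toℚᵘ a     ≈⟨ ℚᵘₚ.*-congʳ (toℚᵘ-ι (+ suc d-1)) ⟨
  toℚᵘ (ι (+ suc d-1)) ℚᵘ.* toℚᵘ a   ≈⟨ ℚₚ.toℚᵘ-homo-* (ι (+ suc d-1)) a ⟨
  toℚᵘ (ι (+ suc d-1) * a)           ∎)
  where
  open import Relation.Binary.Reasoning.Setoid ℚᵘₚ.≃-setoid
  lemma : ∀ n d → n ℤ.* (1ℤ ℤ.* d) ≡ d ℤ.* n ℤ.* 1ℤ
  lemma = solve-∀

-- A positive factor cancels from `≤` in both directions, and antisymmetry gives equality.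
ι*≡0⇒≡0 : ∀ d .{{_ : NonZero d}} {x} → ι (+ d) * x ≡ ℚ.0ℚ → x ≡ ℚ.0ℚ
ι*≡0⇒≡0 d {x} dx≡0 = ℚₚ.≤-antisym
  (ℚₚ.*-cancelˡ-≤-pos (ι (+ d)) (ℚₚ.≤-reflexive dx≡d0))
  (ℚₚ.*-cancelˡ-≤-pos (ι (+ d)) (ℚₚ.≤-reflexive (sym dx≡d0)))
  where
  instance
    d>0 : ℚ.Positive (ι (+ d))
    d>0 = ℚₚ.normalize-pos d 1
  dx≡d0 : ι (+ d) * x ≡ ι (+ d) * ℚ.0ℚ
  dx≡d0 = trans dx≡0 (sym (ℚₚ.*-zeroʳ (ι (+ d))))

-- From products of rational coefficient lists to integer convolution

coeff-+ₚ : ∀ p q i → coeff (p +ₚ q) i ≡ coeff p i ℚ.+ coeff q i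
coeff-+ₚ []      q       i       = sym (ℚₚ.+-identityˡ (coeff q i))
coeff-+ₚ (a ∷ p) []      i       = sym (ℚₚ.+-identityʳ (coeff (a ∷ p) i))
coeff-+ₚ (a ∷ p) (b ∷ q) zero    = refl
coeff-+ₚ (a ∷ p) (b ∷ q) (suc i) = coeff-+ₚ p q i

coeff-map-* : ∀ a p i → coeff (map (a *_) p) i ≡ a * coeff p i
coeff-map-* a []      i       = sym (ℚₚ.*-zeroʳ a)
coeff-map-* a (b ∷ p) zero    = refl
coeff-map-* a (b ∷ p) (suc i) = coeff-map-* a p i

coeff-∷-*ₚ : ∀ a p q i → coeff ((a ∷ p) *ₚ q) i ≡ a * coeff q i ℚ.+ coeff (ℚ.0ℚ ∷ (p *ₚ q)) i
coeff-∷-*ₚ a p q i = trans (coeff-+ₚ (map (a *_) q) _ i) (cong (ℚ._+ _) (coeff-map-* a q i))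

-- The scalars `x` and `y` stand for the cleared denominators. They stay fixed in the induction on
-- `p`, along which both products unfold in the same way.
ι-⊛ : ∀ x y p q {f g} → (∀ i → ι (f i) ≡ x * coeff p i) → (∀ i → ι (g i) ≡ y * coeff q i) →
      ∀ i → ι ((f ⊛ g) i) ≡ x * y * coeff (p *ₚ q) i
ι-⊛ x y [] q {f} {g} fp gq i = trans
  (cong ι (⊛-zeroˡ g (λ j → ι-injective (trans (fp j) (ℚₚ.*-zeroʳ x))) i))
  (sym (ℚₚ.*-zeroʳ (x * y)))
ι-⊛ x y (a ∷ p) q {f} {g} fp gq zero = begin
  ι (f 0 ℤ.* g 0)                            ≡⟨ ι-* (f 0) (g 0) ⟩
  ι (f 0) * ι (g 0)                          ≡⟨ cong₂ _*_ (fp 0) (gq 0) ⟩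
  x * a * (y * coeff q 0)                    ≡⟨ lemma x y a (coeff q 0) ⟩
  x * y * (a * coeff q 0 ℚ.+ ℚ.0ℚ)           ≡⟨ cong (x * y *_) (coeff-∷-*ₚ a p q 0) ⟨
  x * y * coeff ((a ∷ p) *ₚ q) 0             ∎
  where
  open ≡-Reasoning
  lemma : ∀ x y a b → x * a * (y * b) ≡ x * y * (a * b ℚ.+ ℚ.0ℚ)
  lemma = solve 4 (λ x y a b → x :* a :* (y :* b) := x :* y :* (a :* b :+ con ℚ.0ℚ)) refl
    where open ℚ-Solver
ι-⊛ x y (a ∷ p) q {f} {g} fp gq (suc i) = begin
  ι (f 0 ℤ.* g (suc i) ℤ.+ (tail f ⊛ g) i)
    ≡⟨ ι-+ (f 0 ℤ.* g (suc i)) _ ⟩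
  ι (f 0 ℤ.* g (suc i)) ℚ.+ ι ((tail f ⊛ g) i)
    ≡⟨ cong₂ ℚ._+_ (trans (ι-* (f 0) (g (suc i))) (cong₂ _*_ (fp 0) (gq (suc i))))
                   (ι-⊛ x y p q (fp ∘ suc) gq i) ⟩
  x * a * (y * coeff q (suc i)) ℚ.+ x * y * coeff (p *ₚ q) i
    ≡⟨ lemma x y a (coeff q (suc i)) (coeff (p *ₚ q) i) ⟩
  x * y * (a * coeff q (suc i) ℚ.+ coeff (p *ₚ q) i)
    ≡⟨ cong (x * y *_) (coeff-∷-*ₚ a p q (suc i)) ⟨
  x * y * coeff ((a ∷ p) *ₚ q) (suc i) ∎
  where
  open ≡-Reasoning
  lemma : ∀ x y a b r → x * a * (y * b) ℚ.+ x * y * r ≡ x * y * (a * b ℚ.+ r)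
  lemma = solve 5 (λ x y a b r → x :* a :* (y :* b) :+ x :* y :* r := x :* y :* (a :* b :+ r)) refl
    where open ℚ-Solver

-- The bound is the list length and not the degree, as trailing zeros are allowed.
record IntegerMultiple (p : Poly) : Set where
  field
    denominator : ℕ
    {{nonZero}} : NonZero denominator
    numerator   : Series
    numerator-∞ : VanishesFrom (length p) numerator
    ι-numerator : ∀ i → ι (numerator i) ≡ ι (+ denominator) * coeff p i

  constant : Constant numerator → IsConstant p
  constant num∞ i = ι*≡0⇒≡0 denominator
    (trans (sym (ι-numerator (suc i))) (cong ι (num∞ (suc i) (s≤s z≤n))))

clear : ∀ p → IntegerMultiple p
clear []      = record
  { denominator = 1
  ; numerator   = λ _ → 0ℤ
  ; numerator-∞ = λ _ _ → refl
  ; ι-numerator = λ _ → refl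
  }
clear (a ∷ p) = record
  -- The plain product of all denominators serves; it need not be the least common one.
  { denominator = ℚ.↧ₙ a ℕ.* D
  ; nonZero     = ℕₚ.m*n≢0 (ℚ.↧ₙ a) D {{_}} {{nonZero}}
  ; numerator   = num
  ; numerator-∞ = λ { (suc i) (s≤s l≤i) →
      trans (cong (ℚ.↧ a ℤ.*_) (numerator-∞ i l≤i)) (ℤₚ.*-zeroʳ (ℚ.↧ a)) }
  ; ι-numerator = λ i → trans (ι-num i) (cong (_* coeff (a ∷ p) i)
      (trans (sym (ι-* (ℚ.↧ a) (+ D))) (cong ι (sym (ℤₚ.pos-* (ℚ.↧ₙ a) D)))))
  }
  where
  open IntegerMultiple (clear p) renaming (denominator to D)
  num : Series
  num zero    = ℚ.↥ a ℤ.* + D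
  num (suc i) = ℚ.↧ a ℤ.* numerator i
  ι-num : ∀ i → ι (num i) ≡ ι (ℚ.↧ a) * ι (+ D) * coeff (a ∷ p) i
  ι-num zero    = trans (ι-* (ℚ.↥ a) (+ D)) (trans (cong (_* ι (+ D)) (ι-↥ a))
    (lemma (ι (ℚ.↧ a)) a (ι (+ D))))
    where
    lemma : ∀ x a y → x * a * y ≡ x * y * a
    lemma = solve 3 (λ x a y → x :* a :* y := x :* y :* a) refl
      where open ℚ-Solver
  ι-num (suc i) = trans (ι-* (ℚ.↧ a) (numerator i)) (trans (cong (ι (ℚ.↧ a) *_) (ι-numerator i))
    (sym (ℚₚ.*-assoc (ι (ℚ.↧ a)) (ι (+ D)) (coeff p i))))

-- With denominators `D` and `E` cleared, the integer factors multiply to `D E h`, and `gauss`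
-- removes the prime factors of `D E`.
irreducible-over-ℚ : ∀ {f h} → (∀ i → coeff f i ≡ ι (h i)) → IrreducibleOverℤ h →
                     ∀ g₁ g₂ → f ≈ₚ (g₁ *ₚ g₂) → IsConstant g₁ ⊎ IsConstant g₂
irreducible-over-ℚ {f} {h} fh irr g₁ g₂ f≈g₁g₂ =
  Sum.map M₁.constant M₂.constant
    (gauss irr factors factorsPrime (length g₁) (length g₂) M₁.numerator M₂.numerator
      M₁.numerator-∞ M₂.numerator-∞ (λ i → ι-injective (product-of-numerators i)))
  where
  module M₁ = IntegerMultiple (clear g₁)
  module M₂ = IntegerMultiple (clear g₂)
  D E : ℕ
  D = M₁.denominator
  E = M₂.denominator
  instance
    DE≢0 : NonZero (D ℕ.* E)
    DE≢0 = ℕₚ.m*n≢0 D E {{M₁.nonZero}} {{M₂.nonZero}}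
  open PrimeFactorisation (factorise (D ℕ.* E))
  product-of-numerators : ∀ i → ι ((M₁.numerator ⊛ M₂.numerator) i) ≡ ι (+ product factors ℤ.* h i)
  product-of-numerators i = begin
    ι ((M₁.numerator ⊛ M₂.numerator) i)       ≡⟨ ι-⊛ (ι (+ D)) (ι (+ E)) g₁ g₂ M₁.ι-numerator M₂.ι-numerator i ⟩
    ι (+ D) * ι (+ E) * coeff (g₁ *ₚ g₂) i    ≡⟨ cong (ι (+ D) * ι (+ E) *_) (trans (sym (f≈g₁g₂ i)) (fh i)) ⟩
    ι (+ D) * ι (+ E) * ι (h i)               ≡⟨ cong (_* ι (h i)) (ι-* (+ D) (+ E)) ⟨
    ι (+ D ℤ.* + E) * ι (h i)                 ≡⟨ cong (λ z → ι z * ι (h i)) (ℤₚ.pos-* D E) ⟨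
    ι (+ (D ℕ.* E)) * ι (h i)                 ≡⟨ cong (λ z → ι (+ z) * ι (h i)) isFactorisation ⟩
    ι (+ product factors) * ι (h i)           ≡⟨ ι-* (+ product factors) (h i) ⟨
    ι (+ product factors ℤ.* h i)             ∎
    where open ≡-Reasoning

-- The trinomial over ℚ

coeff-X^ : ∀ n i → coeff (X^ n) i ≡ ι (X^ℤ n i)
coeff-X^ zero    zero    = refl
coeff-X^ zero    (suc i) = refl
coeff-X^ (suc n) zero    = refl
coeff-X^ (suc n) (suc i) = coeff-X^ n i

coeff-trinomial : ∀ e c n i →
  coeff ((X^ (2 ℕ.+ n) +ₚ (C (ι e) *ₚ X^ 1)) +ₚ C (ι c)) i ≡ ι (trinomial c e n i)
coeff-trinomial e c n zero = lemma (ι e) (ι c)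
  where
  lemma : ∀ x y → ℚ.0ℚ ℚ.+ (x * ℚ.0ℚ ℚ.+ ℚ.0ℚ) ℚ.+ y ≡ y
  lemma = solve 2 (λ x y → con ℚ.0ℚ :+ (x :* con ℚ.0ℚ :+ con ℚ.0ℚ) :+ y := y) refl
    where open ℚ-Solver
coeff-trinomial e c n (suc zero) = trans (ℚₚ.+-identityˡ _) (ℚₚ.*-identityʳ (ι e))
-- Past the two lowest coefficients the sum reduces to `X^ n +ₚ []`.
coeff-trinomial e c n (suc (suc i)) =
  trans (coeff-+ₚ (X^ n) [] i) (trans (ℚₚ.+-identityʳ _) (coeff-X^ n i))

sign : ∀ {ε} → ε ≡ 1ℚ ⊎ ε ≡ - 1ℚ → ∃[ e ] ι e ≡ ε × ∣ e ∣ ≡ 1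
sign (inj₁ refl) = + 1 , refl , refl
sign (inj₂ refl) = ℤ.-1ℤ , refl , refl

theorem2 : (p k n : ℕ) → Prime p → 2 ≤ k → 2 ≤ n →
    (ε₁ ε₂ : ℚ) → (ε₁ ≡ 1ℚ ⊎ ε₁ ≡ - 1ℚ) → (ε₂ ≡ 1ℚ ⊎ ε₂ ≡ - 1ℚ) →
    Irreducible ((X^ n +ₚ (C ε₁ *ₚ X^ 1)) +ₚ C (ε₂ * ℕ→ℚ (p ^ k)))
theorem2 p k (suc (suc n)) pr 2≤k (s≤s (s≤s _)) ε₁ ε₂ ε₁-sign ε₂-sign
  with sign ε₁-sign | sign ε₂-sign
... | e , refl , ∣e∣≡1 | s , refl , ∣s∣≡1 = not-constant , irreducible-over-ℚ {f} f≗ irr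
  where
  c : ℤ
  c = s ℤ.* + (p ^ k)
  f : Poly
  f = (X^ (2 ℕ.+ n) +ₚ (C (ι e) *ₚ X^ 1)) +ₚ C (ι s * ι (+ (p ^ k)))
  f≗ : ∀ i → coeff f i ≡ ι (trinomial c e n i)
  f≗ i = trans
    (cong (λ z → coeff ((X^ (2 ℕ.+ n) +ₚ (C (ι e) *ₚ X^ 1)) +ₚ C z) i) (sym (ι-* s (+ (p ^ k)))))
    (coeff-trinomial e c n i)
  ∣c∣≡pᵏ : ∣ c ∣ ≡ p ^ k
  ∣c∣≡pᵏ = trans (ℤₚ.abs-* s (+ (p ^ k))) (trans (cong (ℕ._* p ^ k) ∣s∣≡1) (ℕₚ.*-identityˡ (p ^ k)))
  irr : IrreducibleOverℤ (trinomial c e n)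
  irr = trinomial-irreducible k pr 2≤k c e n ∣c∣≡pᵏ ∣e∣≡1
  not-constant : ¬ IsConstant f
  not-constant f-constant
    -- Constancy would make the linear coefficient `e` zero, while its absolute value is 1.
    with trans (sym ∣e∣≡1)
           (cong ∣_∣ (ι-injective {e} {0ℤ} (trans (sym (f≗ 1)) (f-constant 0))))
  ... | ()
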